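{- For every integer $n\ge 3$, $m(n,n-1)\ge \lg n$.
   Context: A hypergraph is an ordered pair $(X,H)$ such that $X$ is a set and $H$ is a family of subsets of $X$; elements of $X$ are its vertices and members of $H$ are its edges (edges may have arbitrary sizes). For any two distinct vertices $u,v$ of a hypergraph $(X,H)$, the line $\overline{uv}$ is the set $\{u,v\}\cup\{p\in X:\ \exists\, T\in H \text{ with } \{u,v,p\}\subseteq T\}$. The lines of the hypergraph are all the sets $\overline{uv}$ with $u,v$ distinct vertices; the number of lines is the number of distinct such sets. For integers $n,k$, $m(n,k)$ denotes the smallest number of (distinct) lines in a hypergraph on $n$ vertices where every line consists of at most $k$ vertices. $\lg$ denotes the logarithm to base $2$. -}

module Defs where

open import Data.Bool.Base using (Bool; true; false; T)
import Data.Bool.Properties as Bool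
open import Data.Fin.Base using (Fin)
import Data.Fin.Properties as Fin
open import Data.Fin.Subset
  using (Subset; inside; outside; _∈_; _⊆_; _∪_; ⁅_⁆; ∣_∣)
open import Data.Fin.Subset.Properties
  using (_∈?_; anySubset?; p⊆q⇒∣p∣≤∣q∣; ∣⁅x⁆∣≡1; x∈⁅x⁆; x∈p∪q⁺)
open import Data.List.Base
  using (List; allFin; cartesianProduct; deduplicate; filter; length; map)
open import Data.List.Properties using (map-cong)
open import Data.Nat.Base using (ℕ; zero; suc; _+_; _≤_; _<_; z≤n; s≤s)
open import Data.Nat.Induction using (<-rec)
open import Data.Nat.Properties
  using (_≟_; _≤?_; ≤-refl; ≤-trans; ≤-reflexive; m≤n⇒m≤1+n; +-monoʳ-≤; ≮⇒≥;
         anyUpTo?; module ≤-Reasoning; +-suc)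
open import Data.Product.Base using (∃; ∃-syntax; _×_; _,_; proj₁; proj₂; uncurry)
open import Data.Sum.Base using (_⊎_; inj₁; inj₂)
open import Data.Vec.Base using ([]; _∷_; tabulate)
open import Data.Vec.Properties using (≡-dec; tabulate-cong; lookup∘tabulate; []=⇒lookup)
open import Function.Base using (_∘_)
open import Function.Bundles using (mk⇔)
open import Level using (0ℓ)
open import Relation.Binary.Definitions using (DecidableEquality)
open import Relation.Binary.PropositionalEquality
  using (_≡_; _≢_; _≗_; refl; sym; trans; cong; cong₂; subst)
open import Relation.Nullary using (Dec; yes; no; does; ¬?)
open import Relation.Nullary.Decidable
  using (map′; _×-dec_; _⊎-dec_; _→-dec_; does-⇔)
open import Relation.Unary using (Pred; Decidable)

private
  variable
    n : ℕ

-- The vertex set is Fin n; the set of edges is given by its characteristic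
-- function, just as Subset n gives a set of vertices.

Hypergraph : ℕ → Set
Hypergraph n = Subset n → Bool

IsEdge : Hypergraph n → Pred (Subset n) 0ℓ
IsEdge H e = T (H e)

OnLine : Hypergraph n → (u v p : Fin n) → Set
OnLine H u v p =
  (p ≡ u ⊎ p ≡ v) ⊎ (∃[ e ] IsEdge H e × u ∈ e × v ∈ e × p ∈ e)

onLine? : (H : Hypergraph n) (u v : Fin n) → Decidable (OnLine H u v)
onLine? H u v p =
  (p Fin.≟ u ⊎-dec p Fin.≟ v) ⊎-dec
  anySubset? (λ e → Bool.T? (H e) ×-dec u ∈? e ×-dec v ∈? e ×-dec p ∈? e)

line : Hypergraph n → (u v : Fin n) → Subset n
line H u v = tabulate (λ p → does (onLine? H u v p))

distinctPairs : ∀ n → List (Fin n × Fin n)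
distinctPairs n =
  filter (λ (u , v) → ¬? (u Fin.≟ v)) (cartesianProduct (allFin n) (allFin n))

_≟ˢ_ : DecidableEquality (Subset n)
_≟ˢ_ = ≡-dec Bool._≟_

lines : Hypergraph n → List (Subset n)
lines {n} H = deduplicate _≟ˢ_ (map (uncurry (line H)) (distinctPairs n))

numLines : Hypergraph n → ℕ
numLines H = length (lines H)

LinesAtMost : ℕ → Hypergraph n → Set
LinesAtMost k H = ∀ u v → u ≢ v → ∣ line H u v ∣ ≤ k

IsLineCount : (n k : ℕ) → Pred ℕ 0ℓ
IsLineCount n k c = ∃[ H ] LinesAtMost {n} k H × numLines H ≡ c

IsLeast : Pred ℕ 0ℓ → Pred ℕ 0ℓ
IsLeast P x = P x × (∀ y → P y → x ≤ y)

least : ∀ {P : Pred ℕ 0ℓ} → Decidable P → ∃ P → ∃ (IsLeast P)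
least {P} P? (x , Px) = <-rec (λ x → P x → ∃ (IsLeast P)) step x Px
  where
  step : ∀ x → (∀ {y} → y < x → P y → ∃ (IsLeast P)) → P x → ∃ (IsLeast P)
  step x rec Px with anyUpTo? P? x
  ... | yes (y , y<x , Py) = rec y<x Py
  ... | no  ∄y             = x , Px , λ y Py → ≮⇒≥ (λ y<x → ∄y (y , y<x , Py))

-- Hypergraphs on n vertices can be searched exhaustively, up to pointwise
-- equality.

private
  glue : Hypergraph n → Hypergraph n → Hypergraph (suc n)
  glue F G (inside  ∷ e) = F e
  glue F G (outside ∷ e) = G e

  glue-cong : ∀ {F F′ G G′ : Hypergraph n} → F ≗ F′ → G ≗ G′ → glue F G ≗ glue F′ G′
  glue-cong F≗ G≗ (inside  ∷ e) = F≗ e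
  glue-cong F≗ G≗ (outside ∷ e) = G≗ e

  glue-η : (H : Hypergraph (suc n)) → H ≗ glue (H ∘ (inside ∷_)) (H ∘ (outside ∷_))
  glue-η H (inside  ∷ e) = refl
  glue-η H (outside ∷ e) = refl

anyHypergraph? : ∀ {n} {Q : Pred (Hypergraph n) 0ℓ} →
                 (∀ {H G} → H ≗ G → Q H → Q G) → Decidable Q → Dec (∃ Q)
anyHypergraph? {zero} {Q} resp Q? =
  map′ from to (Q? (λ _ → true) ⊎-dec Q? (λ _ → false))
  where
  from : Q (λ _ → true) ⊎ Q (λ _ → false) → ∃ Q
  from (inj₁ q) = _ , q
  from (inj₂ q) = _ , q
  to : ∃ Q → Q (λ _ → true) ⊎ Q (λ _ → false)
  to (H , q) with H [] in eq
  ... | true  = inj₁ (resp (λ where [] → eq) q)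
  ... | false = inj₂ (resp (λ where [] → eq) q)
anyHypergraph? {suc n} {Q} resp Q? =
  map′ (λ (F , G , q) → glue F G , q)
       (λ (H , q) → _ , _ , resp (glue-η H) q)
       (anyHypergraph? (λ F≗ (G , q) → G , resp (glue-cong F≗ (λ _ → refl)) q) λ F →
        anyHypergraph? (λ G≗ → resp (glue-cong {F = F} (λ _ → refl) G≗)) λ G →
        Q? (glue F G))

OnLine-cong : ∀ {H G : Hypergraph n} → H ≗ G → ∀ {u v p} → OnLine H u v p → OnLine G u v p
OnLine-cong H≗G (inj₁ p≡)         = inj₁ p≡
OnLine-cong H≗G (inj₂ (e , h , r)) = inj₂ (e , subst T (H≗G e) h , r)

line-cong : ∀ {H G : Hypergraph n} → H ≗ G → ∀ u v → line H u v ≡ line G u v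
line-cong {H = H} {G} H≗G u v = tabulate-cong λ p →
  does-⇔ (mk⇔ (OnLine-cong H≗G) (OnLine-cong (sym ∘ H≗G)))
         (onLine? H u v p) (onLine? G u v p)

numLines-cong : ∀ {H G : Hypergraph n} → H ≗ G → numLines H ≡ numLines G
numLines-cong {n} H≗G =
  cong (length ∘ deduplicate _≟ˢ_)
       (map-cong (λ (u , v) → line-cong H≗G u v) (distinctPairs n))

linesAtMost? : ∀ k → Decidable (LinesAtMost {n} k)
linesAtMost? k H = Fin.all? λ u → Fin.all? λ v →
  ¬? (u Fin.≟ v) →-dec (∣ line H u v ∣ ≤? k)

isLineCount? : ∀ n k → Decidable (IsLineCount n k)
isLineCount? n k c = anyHypergraph?
  (λ H≗G (ok , eq) →
    (λ u v u≢v → subst (λ ℓ → ∣ ℓ ∣ ≤ k) (line-cong H≗G u v) (ok u v u≢v)) ,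
    trans (sym (numLines-cong H≗G)) eq)
  (λ H → linesAtMost? k H ×-dec numLines H ≟ c)

private
  ∣p∪q∣≤∣p∣+∣q∣ : (p q : Subset n) → ∣ p ∪ q ∣ ≤ ∣ p ∣ + ∣ q ∣
  ∣p∪q∣≤∣p∣+∣q∣ []            []            = z≤n
  ∣p∪q∣≤∣p∣+∣q∣ (outside ∷ p) (outside ∷ q) = ∣p∪q∣≤∣p∣+∣q∣ p q
  ∣p∪q∣≤∣p∣+∣q∣ (outside ∷ p) (inside  ∷ q) =
    ≤-trans (s≤s (∣p∪q∣≤∣p∣+∣q∣ p q)) (≤-reflexive (sym (+-suc ∣ p ∣ ∣ q ∣)))
  ∣p∪q∣≤∣p∣+∣q∣ (inside  ∷ p) (outside ∷ q) = s≤s (∣p∪q∣≤∣p∣+∣q∣ p q)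
  ∣p∪q∣≤∣p∣+∣q∣ (inside  ∷ p) (inside  ∷ q) =
    s≤s (≤-trans (∣p∪q∣≤∣p∣+∣q∣ p q) (+-monoʳ-≤ ∣ p ∣ (m≤n⇒m≤1+n ≤-refl)))

∈-line⁻ : ∀ (H : Hypergraph n) {u v p} → p ∈ line H u v → OnLine H u v p
∈-line⁻ H {u} {v} {p} p∈ with onLine? H u v p in eq
... | yes on = on
... | no  _  with () ← trans (sym ([]=⇒lookup p∈))
                             (trans (lookup∘tabulate (does ∘ onLine? H u v) p) (cong does eq))

edgeless-linesAtMost-2 : LinesAtMost {n} 2 (λ _ → false)
edgeless-linesAtMost-2 {n} u v _ = begin
  ∣ line H u v ∣        ≤⟨ p⊆q⇒∣p∣≤∣q∣ line⊆ ⟩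
  ∣ ⁅ u ⁆ ∪ ⁅ v ⁆ ∣     ≤⟨ ∣p∪q∣≤∣p∣+∣q∣ ⁅ u ⁆ ⁅ v ⁆ ⟩
  ∣ ⁅ u ⁆ ∣ + ∣ ⁅ v ⁆ ∣ ≡⟨ cong₂ _+_ (∣⁅x⁆∣≡1 u) (∣⁅x⁆∣≡1 v) ⟩
  2                     ∎
  where
  open ≤-Reasoning
  H : Hypergraph n
  H _ = false
  line⊆ : line H u v ⊆ ⁅ u ⁆ ∪ ⁅ v ⁆
  line⊆ p∈ with ∈-line⁻ H p∈
  ... | inj₁ (inj₁ refl)   = x∈p∪q⁺ (inj₁ (x∈⁅x⁆ u))
  ... | inj₁ (inj₂ refl)   = x∈p∪q⁺ (inj₂ (x∈⁅x⁆ v))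
  ... | inj₂ (_ , () , _)

-- Lines have at least two vertices, so for n ≥ 2 the minimum exists exactly
-- when k ≥ 2.

leastLineCount : ∀ n k → 2 ≤ k → ∃ (IsLeast (IsLineCount n k))
leastLineCount n k 2≤k = least (isLineCount? n k)
  (_ , _ , (λ u v u≢v → ≤-trans (edgeless-linesAtMost-2 u v u≢v) 2≤k) , refl)

m : ∀ n k → 2 ≤ k → ℕ
m n k 2≤k = proj₁ (leastLineCount n k 2≤k)

m-isLeast : ∀ n k (2≤k : 2 ≤ k) → IsLeast (IsLineCount n k) (m n k 2≤k)
m-isLeast n k 2≤k = proj₂ (leastLineCount n k 2≤k)

{-# OPTIONS --safe #-}

-- Send each vertex to the set of lines that contain it.  If distinct vertices
-- u and v lie on the same lines then, for every w, v lies on the line uw, so w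
-- lies on the line uv, which is therefore universal.  Without a universal line
-- the map is thus injective, and n is at most 2 to the number of lines.

module Submission where

open import Defs
open import Data.Bool.Base using (Bool)
open import Data.Fin.Base using (Fin; finToFun; funToFin)
import Data.Fin.Properties as Fin
open import Data.Fin.Subset using (Subset; _∈_; ⊤; ∣_∣)
open import Data.Fin.Subset.Properties using (p⊆q⇒∣p∣≤∣q∣; ∣⊤∣≡n)
import Data.List.Base as List
import Data.List.Membership.Propositional as List
open import Data.List.Membership.Propositional.Properties
  using (∈-allFin; ∈-cartesianProduct⁺; ∈-deduplicate⁺; ∈-filter⁺; ∈-map⁺)
open import Data.List.Relation.Unary.Any using (index)
open import Data.List.Relation.Unary.Any.Properties using (lookup-index)
open import Data.Nat.Base using (ℕ; _≤_; _<_; _≥_; _∸_; _^_; s≤s; z≤n)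
open import Data.Nat.Logarithm using (⌈log₂_⌉; ⌈log₂⌉-mono-≤; ⌈log₂2^n⌉≡n)
open import Data.Nat.Properties using (∸-monoˡ-≤; ≤-trans; <⇒≱; module ≤-Reasoning)
open import Data.Product.Base using (_,_; proj₁; uncurry)
open import Data.Sum.Base using (inj₁; inj₂)
open import Data.Vec.Base using (lookup)
open import Data.Vec.Properties using ([]=⇒lookup; lookup⇒[]=; lookup∘tabulate)
open import Function.Base using (_∘_)
open import Function.Bundles using (Inverse; Injection)
open import Function.Definitions using (Injective)
open import Function.Properties.Inverse using (↔-sym; ↔⇒↣)
open import Relation.Binary.PropositionalEquality
open import Relation.Nullary using (yes; no; ¬?; contradiction)
open import Relation.Nullary.Decidable using (dec-true)

private
  variable
    n : ℕ
    H : Hypergraph n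
    u v w : Fin n

∈-line⁺ : OnLine H u v w → w ∈ line H u v
∈-line⁺ {H = H} {u} {v} {w} on = lookup⇒[]= w _
  (trans (lookup∘tabulate _ w) (dec-true (onLine? H u v w) on))

-- An edge witnessing the hypothesis contains all three vertices, so it serves again after the
-- exchange. The case `v ≡ u` must be excluded: `u` is always on the line of `u` and `w`, while `w`
-- need not satisfy `OnLine H u u`.
OnLine-swap : OnLine H u w v → u ≢ v → OnLine H u v w
OnLine-swap (inj₁ (inj₁ v≡u)) u≢v = contradiction (sym v≡u) u≢v
OnLine-swap (inj₁ (inj₂ v≡w)) _ = inj₁ (inj₂ (sym v≡w))
OnLine-swap (inj₂ (e , h , u∈e , w∈e , v∈e)) _ = inj₂ (e , h , u∈e , v∈e , w∈e)

line∈lines : (H : Hypergraph n) → u ≢ v → line H u v List.∈ lines H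
line∈lines {u = u} {v} H u≢v = ∈-deduplicate⁺ _≟ˢ_ (∈-map⁺ (uncurry (line H))
  (∈-filter⁺ (λ (u , v) → ¬? (u Fin.≟ v))
    (∈-cartesianProduct⁺ (∈-allFin u) (∈-allFin v)) u≢v))

sameLines⇒universal : u ≢ v →
  (∀ {ℓ} → ℓ List.∈ lines H → lookup ℓ u ≡ lookup ℓ v) →
  ∀ w → w ∈ line H u v
sameLines⇒universal {u = u} {v} {H} u≢v same w with u Fin.≟ w
-- This case is separate because only pairs of distinct vertices contribute to `lines H`.
... | yes refl = ∈-line⁺ {H = H} (inj₁ (inj₁ refl))
... | no u≢w = ∈-line⁺ {H = H} (OnLine-swap {H = H} (∈-line⁻ H v∈uw) u≢v)
  where
  v∈uw : v ∈ line H u w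
  v∈uw = lookup⇒[]= v _ (trans (sym (same (line∈lines H u≢w)))
    ([]=⇒lookup (∈-line⁺ {H = H} (inj₁ (inj₁ refl)))))

universal⇒size : {p : Subset n} → (∀ w → w ∈ p) → n ≤ ∣ p ∣
universal⇒size {n} {p} all = begin
  n             ≡⟨ ∣⊤∣≡n n ⟨
  ∣ ⊤ {n} ∣     ≤⟨ p⊆q⇒∣p∣≤∣q∣ {p = ⊤} (λ {w} _ → all w) ⟩
  ∣ p ∣         ∎
  where open ≤-Reasoning

bit : Bool → Fin 2
bit = Inverse.from Fin.2↔Bool

bit-injective : Injective _≡_ _≡_ bit
bit-injective = Injection.injective (↔⇒↣ (↔-sym Fin.2↔Bool))

-- Values in `Fin 2` rather than `Bool` let `funToFin` code the set of lines through a vertex as an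
-- element of `Fin (2 ^ numLines H)`.
incidence : (H : Hypergraph n) → Fin n → Fin (numLines H) → Fin 2
incidence H u i = bit (lookup (List.lookup (lines H) i) u)

incidence⇒sameLines : (∀ i → incidence H u i ≡ incidence H v i) →
  ∀ {ℓ} → ℓ List.∈ lines H → lookup ℓ u ≡ lookup ℓ v
incidence⇒sameLines {H = H} {u} {v} eq ℓ∈ =
  -- Each member of the list is the entry at its own index, where the incidences agree.
  subst (λ ℓ → lookup ℓ u ≡ lookup ℓ v) (sym (lookup-index ℓ∈))
    (bit-injective (eq (index ℓ∈)))

-- `finToFun` is a left inverse of `funToFin` up to pointwise equality.
funToFin-injective : ∀ {a b} {f g : Fin a → Fin b} → funToFin f ≡ funToFin g → f ≗ g
funToFin-injective {f = f} {g} eq i = begin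
  f i                              ≡⟨ Fin.finToFun-funToFin f i ⟨
  finToFun (funToFin f) i          ≡⟨ cong (λ k → finToFun k i) eq ⟩
  finToFun (funToFin g) i          ≡⟨ Fin.finToFun-funToFin g i ⟩
  g i                              ∎
  where open ≡-Reasoning

n≤2^numLines : (H : Hypergraph n) → (∀ u v → u ≢ v → ∣ line H u v ∣ < n) →
               n ≤ 2 ^ numLines H
n≤2^numLines {n} H small = Fin.injective⇒≤ {f = funToFin ∘ incidence H} injective
  where
  injective : Injective _≡_ _≡_ (funToFin ∘ incidence H)
  injective {u} {v} eq with u Fin.≟ v
  ... | yes u≡v = u≡v
  -- Equal codes would make the line of `u` and `v` universal, of size at least `n`.
  ... | no u≢v = contradiction
    (universal⇒size (sameLines⇒universal {H = H} u≢v
      (incidence⇒sameLines {H = H} (funToFin-injective eq))))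
    (<⇒≱ (small u v u≢v))

-- As `c` is an integer, bounding it below by the ceiling is the same as bounding it by the real
-- logarithm.
⌈log₂n⌉≤lineCount : ∀ {n c} → 1 ≤ n → IsLineCount n (n ∸ 1) c → ⌈log₂ n ⌉ ≤ c
-- Matching on `s≤s` exposes `n` as a successor, so that size at most `n ∸ 1` becomes size less than
-- `n`.
⌈log₂n⌉≤lineCount {n} {c} (s≤s _) (H , ok , numLines≡c) = begin
  ⌈log₂ n ⌉                ≤⟨ ⌈log₂⌉-mono-≤ (n≤2^numLines H λ u v u≢v → s≤s (ok u v u≢v)) ⟩
  ⌈log₂ 2 ^ numLines H ⌉   ≡⟨ ⌈log₂2^n⌉≡n (numLines H) ⟩
  numLines H               ≡⟨ numLines≡c ⟩
  c                        ∎
  where open ≤-Reasoning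

theorem4 : (n : ℕ) (n≥3 : n ≥ 3) → m n (n ∸ 1) (∸-monoˡ-≤ 1 n≥3) ≥ ⌈log₂ n ⌉
theorem4 n n≥3 = ⌈log₂n⌉≤lineCount (≤-trans (s≤s z≤n) n≥3)
  -- The minimum is attained, so it is itself a line count.
  (proj₁ (m-isLeast n (n ∸ 1) (∸-monoˡ-≤ 1 n≥3)))
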